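{- For any finite digraph $(\mathsf V,\mathsf E)$, the least number of hubs in a hub extension of $(\mathsf V,\mathsf E)$ equals the biclique cover number of $(\mathsf V,\mathsf E)$.
   Context: A digraph $(\mathsf V,\mathsf E)$ consists of a vertex set $\mathsf V$ and an edge set $\mathsf E\subseteq\mathsf V\times\mathsf V$. A biclique of $(\mathsf V,\mathsf E)$ is a pair $A,B\subseteq\mathsf V$ with $A\times B\subseteq\mathsf E$. The biclique cover number of $(\mathsf V,\mathsf E)$ is the least number of bicliques such that the union of the corresponding sets $A\times B$ is $\mathsf E$. A hub extension of $(\mathsf V,\mathsf E)$ is a digraph $(\widetilde{\mathsf V},\widetilde{\mathsf E})$ with a finite hub set $H$ disjoint from $\mathsf V$ and $\widetilde{\mathsf V}=\mathsf V\cup H$, such that 1. for $a,b\in\mathsf V$: $(a,b)\in\mathsf E$ if and only if there is a hub $h\in H$ with $(a,h),(h,b)\in\widetilde{\mathsf E}$; and 2. every edge of $\widetilde{\mathsf E}$ has the form $(a,h)$ or $(h,a)$ for some $h\in H$ and $a\in\mathsf V$. The number of hubs is $|H|$. -}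

module Defs where

open import Data.Fin.Base using (Fin)
open import Data.Nat.Base using (ℕ; _≤_)
open import Data.Product using (_×_; _,_; ∃-syntax)
open import Data.Sum.Base using (_⊎_; inj₁; inj₂)
open import Function.Bundles using (_↔_; _⇔_)
open import Level using (Level; 0ℓ)
open import Relation.Binary.PropositionalEquality using (_≡_)
open import Relation.Unary
  using (Pred; _∈_; _⊆_; _≐_; _⟨×⟩_; ⋃; Decidable)

record Digraph : Set₁ where
  field
    V : Set
    E : Pred (V × V) 0ℓ

-- Decidability of the edge set makes E a finite set as well; classically it
-- is no restriction.
record IsFinite (G : Digraph) : Set where
  open Digraph G
  field
    order    : ℕ
    vertices : V ↔ Fin order
    edge?    : Decidable E

record Biclique (G : Digraph) : Set₁ where
  open Digraph G
  field
    A B     : Pred V 0ℓ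
    A×B⊆E   : (A ⟨×⟩ B) ⊆ E

-- The bicliques are indexed by Fin size and may repeat, which does not affect
-- the least possible size.
record BicliqueCover (G : Digraph) : Set₁ where
  open Digraph G
  open Biclique
  field
    size     : ℕ
    biclique : Fin size → Biclique G
    covers   : (⋃[ i ∶ Fin size ] (A (biclique i) ⟨×⟩ B (biclique i))) ≐ E

-- The disjoint union V ∪ H is rendered as the sum type V ⊎ H.
record HubExtension (G : Digraph) : Set₁ where
  open Digraph G
  field
    H      : Set
    ∣H∣    : ℕ
    finite : H ↔ Fin ∣H∣

  Ṽ : Set
  Ṽ = V ⊎ H

  field
    Ẽ       : Pred (Ṽ × Ṽ) 0ℓ
    viaHub  : ∀ a b →
              (a , b) ∈ E ⇔
              (∃[ h ] ((inj₁ a , inj₂ h) ∈ Ẽ × (inj₂ h , inj₁ b) ∈ Ẽ))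
    hubEdge : ∀ e → e ∈ Ẽ →
              ∃[ h ] ∃[ a ] (e ≡ (inj₁ a , inj₂ h) ⊎ e ≡ (inj₂ h , inj₁ a))

  digraph : Digraph
  digraph = record { V = Ṽ ; E = Ẽ }

IsLeast : {ℓ : Level} → Pred ℕ ℓ → ℕ → Set ℓ
IsLeast P k = k ∈ P × (∀ m → m ∈ P → k ≤ m)

IsBicliqueCoverNumber : Digraph → ℕ → Set₁
IsBicliqueCoverNumber G =
  IsLeast (λ k → ∃[ C ] (BicliqueCover.size {G} C ≡ k))

IsLeastNumberOfHubs : Digraph → ℕ → Set₁
IsLeastNumberOfHubs G =
  IsLeast (λ k → ∃[ X ] (HubExtension.∣H∣ {G} X ≡ k))

{-# OPTIONS --safe #-}
module Submission where

-- A hub h of a hub extension determines the biclique formed by the vertices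
-- with an edge into h and the vertices with an edge from h, and condition (1)
-- says precisely that these bicliques cover E.  Conversely the bicliques of a
-- cover can themselves serve as hubs.  So hub extensions with k hubs exist if
-- and only if covers by k bicliques do (cover⇔hubs), and the two minima agree
-- as soon as one of them exists.
--
-- Existence of a minimum among natural numbers requires, constructively, that
-- the property "there is a cover by k bicliques" be decidable, although the
-- sides of a biclique are arbitrary predicates.  For this, label each edge of
-- a finite list of all edges by a biclique containing it.  Whenever (a , b)
-- and (c , d) have the same label, (a , d) is an edge; conversely, any
-- labelling with this property comes from a cover (labelling⇔cover).  There
-- are finitely many labellings of a finite list by k labels, so their
-- existence is decidable (labelling?), and giving every edge its own label
-- shows that some k works.

open import Defs
open import Data.Empty using (⊥)
open import Data.Fin.Base using (Fin; finToFun; funToFin)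
open import Data.Fin.Properties using (any?; all?; finToFun-funToFin) renaming (_≟_ to _≟ᶠ_)
open import Data.List.Base using (List; allFin; cartesianProduct; filter; length; lookup; map)
open import Data.List.Membership.Propositional using () renaming (_∈_ to _∈ˡ_)
open import Data.List.Membership.Propositional.Properties
  using (∈-allFin; ∈-cartesianProduct⁺; ∈-filter⁺; ∈-filter⁻; ∈-lookup; ∈-map⁺)
open import Data.List.Relation.Unary.Any using (index)
open import Data.List.Relation.Unary.Any.Properties using (lookup-index)
open import Data.Nat.Base using (ℕ; zero; suc; z≤n; s≤s)
open import Data.Product using (_×_; _,_; ∃-syntax; proj₁; proj₂)
open import Data.Sum.Base using (inj₁; inj₂)
open import Function.Base using (_∘_; id)
open import Function.Bundles using (_⇔_; mk⇔; module Equivalence; module Inverse)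
open import Function.Construct.Identity using (↔-id)
open import Level using (Level)
open import Relation.Binary.PropositionalEquality
  using (_≡_; _≗_; refl; sym; trans; cong; subst)
open import Relation.Nullary using (Dec; yes; no; contradiction)
open import Relation.Nullary.Decidable using (map′; _→-dec_)
open import Relation.Unary using (Pred; _∈_; Decidable)

private
  variable
    ℓ₁ ℓ₂ : Level

-- Least elements of predicates on ℕ

least : {P : Pred ℕ ℓ₁} → Decidable P → ∀ m → m ∈ P → ∃[ k ] IsLeast P k
least P? zero    p = zero , p , λ _ _ → z≤n
least P? (suc m) p with P? zero
... | yes p₀ = zero , p₀ , λ _ _ → z≤n
... | no ¬p₀ with least (P? ∘ suc) m p
...   | k , pk , k≤ = suc k , pk , λ where
        zero    p₀ → contradiction p₀ ¬p₀
        (suc j) pj → s≤s (k≤ j pj)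

IsLeast-resp-⇔ : {P : Pred ℕ ℓ₁} {Q : Pred ℕ ℓ₂} → (∀ k → P k ⇔ Q k) →
                 ∀ {k} → IsLeast P k → IsLeast Q k
IsLeast-resp-⇔ P⇔Q (pk , k≤) =
  Equivalence.to (P⇔Q _) pk , λ m qm → k≤ m (Equivalence.from (P⇔Q m) qm)

-- Searching a finite function space

-- The functions Fin m → Fin k are enumerated by Fin (k ^ m) only up to
-- pointwise equality, whence the hypothesis that P respects it.
anyFun? : ∀ {m k} {P : Pred (Fin m → Fin k) ℓ₁} →
          (∀ {f g} → f ≗ g → P f → P g) → Decidable P → Dec (∃[ f ] P f)
anyFun? resp P? = map′
  (λ (i , p) → finToFun i , p)
  (λ (f , p) → funToFin f , resp (λ x → sym (finToFun-funToFin f x)) p)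
  (any? (P? ∘ finToFun))

-- Hub extensions and biclique covers

module _ {G : Digraph} where
  open Digraph G

  -- The bicliques have to be indexed by Fin ∣H∣, so the hubs are renamed along
  -- the enumeration of H.
  hubs→cover : (X : HubExtension G) →
               ∃[ C ] BicliqueCover.size {G} C ≡ HubExtension.∣H∣ X
  hubs→cover X = cover , refl
    where
    open HubExtension X
    open Inverse finite using (to; from; strictlyInverseʳ)

    cover : BicliqueCover G
    cover = record
      { size     = ∣H∣
      ; biclique = λ i → record
        { A     = λ a → (inj₁ a , inj₂ (from i)) ∈ Ẽ
        ; B     = λ b → (inj₂ (from i) , inj₁ b) ∈ Ẽ
        ; A×B⊆E = λ {(a , b)} (ah , hb) →
            Equivalence.from (viaHub a b) (from i , ah , hb)
        }
      ; covers = (λ {(a , b)} (i , ah , hb) →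
                    Equivalence.from (viaHub a b) (from i , ah , hb))
               , λ {(a , b)} e →
                   let h , ah , hb = Equivalence.to (viaHub a b) e
                       h≡ = sym (strictlyInverseʳ h)
                   in to h , subst (λ h → (inj₁ a , inj₂ h) ∈ Ẽ) h≡ ah
                           , subst (λ h → (inj₂ h , inj₁ b) ∈ Ẽ) h≡ hb
      }

  -- The hubs are the indices of the bicliques: the edges into the hub i come
  -- from the side A of the biclique i, and those out of it go to the side B.
  cover→hubs : (C : BicliqueCover G) →
               ∃[ X ] HubExtension.∣H∣ {G} X ≡ BicliqueCover.size C
  cover→hubs C = extension , refl
    where
    open BicliqueCover C
    open Biclique

    extension : HubExtension G
    extension = record
      { H       = Fin size
      ; ∣H∣     = size
      ; finite  = ↔-id _
      ; Ẽ       = λ where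
          (inj₁ a , inj₂ i) → a ∈ A (biclique i)
          (inj₂ i , inj₁ b) → b ∈ B (biclique i)
          (inj₁ _ , inj₁ _) → ⊥
          (inj₂ _ , inj₂ _) → ⊥
      ; viaHub  = λ a b → mk⇔ (proj₂ covers) (proj₁ covers)
      ; hubEdge = λ where
          (inj₁ a , inj₂ i) _ → i , a , inj₁ refl
          (inj₂ i , inj₁ b) _ → i , b , inj₂ refl
      }

  cover⇔hubs : ∀ k → (∃[ C ] BicliqueCover.size {G} C ≡ k) ⇔
                     (∃[ X ] HubExtension.∣H∣ {G} X ≡ k)
  cover⇔hubs k = mk⇔ (λ { (C , refl) → cover→hubs C })
                     (λ { (X , refl) → hubs→cover X })

-- Biclique covers and edge labellings

-- A labelling f of the list es of pairs of vertices such that, for each label,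
-- the first and the second components of the pairs carrying it form the two
-- sides of a biclique.  Positions in es are labelled rather than pairs, so a
-- pair that occurs several times in es may carry several labels.
IsBicliqueLabelling : (G : Digraph) (es : List (Digraph.V G × Digraph.V G))
                      {k : ℕ} → (Fin (length es) → Fin k) → Set
IsBicliqueLabelling G es f = ∀ i j → f i ≡ f j →
  (proj₁ (lookup es i) , proj₂ (lookup es j)) ∈ Digraph.E G

-- The existence of such a labelling with k labels, not all of which need occur.
BicliqueLabelling : (G : Digraph) → List (Digraph.V G × Digraph.V G) → ℕ → Set
BicliqueLabelling G es k =
  ∃[ f ] IsBicliqueLabelling G es {k} f

labelling? : ∀ {G} → Decidable (Digraph.E G) → ∀ es →
             Decidable (BicliqueLabelling G es)
labelling? E? es k = anyFun?
  (λ f≗g p i j gi≡gj → p i j (trans (f≗g i) (trans gi≡gj (sym (f≗g j)))))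
  (λ f → all? λ i → all? λ j → (f i ≟ᶠ f j) →-dec E? _)

module _ {G : Digraph} (es : List (Digraph.V G × Digraph.V G))
         (complete : ∀ {e} → e ∈ Digraph.E G → e ∈ˡ es)
         (sound    : ∀ {e} → e ∈ˡ es → e ∈ Digraph.E G) where
  open Digraph G

  edgeAt : ∀ i → lookup es i ∈ E
  edgeAt i = sound (∈-lookup i)

  -- The label of an edge is the index of a biclique containing it; the proof
  -- that the cover contains E supplies this index.
  cover→labelling : (C : BicliqueCover G) →
                    BicliqueLabelling G es (BicliqueCover.size C)
  cover→labelling C = label , isLabelling
    where
    open BicliqueCover C
    open Biclique

    chosen : ∀ i → ∃[ c ] (proj₁ (lookup es i) ∈ A (biclique c) ×
                           proj₂ (lookup es i) ∈ B (biclique c))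
    chosen i = proj₂ covers (edgeAt i)

    label : Fin (length es) → Fin size
    label = proj₁ ∘ chosen

    isLabelling : IsBicliqueLabelling G es label
    isLabelling i j same = A×B⊆E (biclique (label i))
      ( proj₁ (proj₂ (chosen i))
      , subst (λ c → proj₂ (lookup es j) ∈ B (biclique c)) (sym same)
              (proj₂ (proj₂ (chosen j))) )

  -- The biclique of a label consists of the sources and the targets of the
  -- edges carrying that label.
  labelling→cover : ∀ {k} → BicliqueLabelling G es k →
                    ∃[ C ] BicliqueCover.size {G} C ≡ k
  labelling→cover {k} (f , isLabelling) = cover , refl
    where
    biclique : Fin k → Biclique G
    biclique c = record
      { A     = λ a → ∃[ i ] (f i ≡ c × proj₁ (lookup es i) ≡ a)
      ; B     = λ b → ∃[ j ] (f j ≡ c × proj₂ (lookup es j) ≡ b)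
      ; A×B⊆E = λ { ((i , fi≡c , refl) , (j , fj≡c , refl)) →
                    isLabelling i j (trans fi≡c (sym fj≡c)) }
      }

    cover : BicliqueCover G
    cover = record
      { size     = k
      ; biclique = biclique
      ; covers   = (λ (c , ab) → Biclique.A×B⊆E (biclique c) ab)
                 , λ e → let e∈es = complete e
                             i    = index e∈es
                             eq   = sym (lookup-index e∈es)
                         in f i , (i , refl , cong proj₁ eq)
                                , (i , refl , cong proj₂ eq)
      }

  labelling⇔cover : ∀ k → BicliqueLabelling G es k ⇔
                          (∃[ C ] BicliqueCover.size {G} C ≡ k)
  labelling⇔cover k = mk⇔ labelling→cover
                          (λ { (C , refl) → cover→labelling C })

  -- A single edge forms a biclique.
  distinctLabels : BicliqueLabelling G es (length es)
  distinctLabels = id , λ { i .i refl → edgeAt i }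

  coverNumber : Decidable E → ∃[ k ] IsBicliqueCoverNumber G k
  coverNumber E? with least (labelling? {G} E? es) (length es) distinctLabels
  ... | k , isLeast = k , IsLeast-resp-⇔ labelling⇔cover isLeast

-- Finite digraphs

module _ {G : Digraph} (fin : IsFinite G) where
  open Digraph G
  open IsFinite fin
  open Inverse vertices using (to; from; strictlyInverseʳ)

  -- All vertices, in the order given by the enumeration of V.
  vertexList : List V
  vertexList = map from (allFin order)

  ∈-vertexList : ∀ v → v ∈ˡ vertexList
  ∈-vertexList v =
    subst (_∈ˡ vertexList) (strictlyInverseʳ v) (∈-map⁺ from (∈-allFin (to v)))

  -- All edges, obtained by testing every pair of vertices; each edge occurs
  -- exactly once.
  edgeList : List (V × V)
  edgeList = filter edge? (cartesianProduct vertexList vertexList)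

  ∈-edgeList⁺ : ∀ {e} → e ∈ E → e ∈ˡ edgeList
  ∈-edgeList⁺ {a , b} =
    ∈-filter⁺ edge? (∈-cartesianProduct⁺ (∈-vertexList a) (∈-vertexList b))

  ∈-edgeList⁻ : ∀ {e} → e ∈ˡ edgeList → e ∈ E
  ∈-edgeList⁻ e∈ =
    proj₂ (∈-filter⁻ edge? {xs = cartesianProduct vertexList vertexList} e∈)

lemma2p1 : (G : Digraph) → IsFinite G →
    ∃[ k ] (IsLeastNumberOfHubs G k × IsBicliqueCoverNumber G k)
lemma2p1 G fin
  with coverNumber (edgeList fin) (∈-edgeList⁺ fin) (∈-edgeList⁻ fin)
                   (IsFinite.edge? fin)
... | k , isCoverNumber = k , IsLeast-resp-⇔ cover⇔hubs isCoverNumber , isCoverNumber
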